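{- Let $\epsilon>0$ be a constant. Let $G$ be a $d$-regular $\epsilon$-vertex-expander on $n$ vertices containing exactly one sink $s$, and let $\sigma$ be a configuration with $N$ chips in total on the non-sink vertices. Then the following greedy simulation algorithm terminates after $O(n^2\log n\,\log(nN))$ iterations: while some non-sink vertex is full, choose a non-sink vertex $u$ maximizing $\lfloor\sigma_u/\deg(u)\rfloor$, let $k=\lfloor\sigma_u/\deg(u)\rfloor$, set $\sigma_u\leftarrow\sigma_u-k\deg(u)$ and add $k$ chips to every non-sink neighbor of $u$ (one iteration = one execution of this loop body).
   Context: An $\epsilon$-vertex-expander is a graph $G$ on $n$ vertices such that every vertex set $X\subset V(G)$ with $|X|\le n/2$ satisfies $|\mathrm{neighbor}(X)\setminus X|\ge\epsilon|X|$, where $\mathrm{neighbor}(X)$ is the set of vertices adjacent to some vertex of $X$. Sandpile with a sink: $\sigma\in\mathbb{N}^{V(G)}$ gives chip counts; the sink never fires and chips sent to it are discarded; a non-sink vertex $v$ is full if $\sigma_v\ge\deg(v)$ (degree counts all neighbors, including $s$); firing $v$ decreases $\sigma_v$ by $\deg(v)$ and adds one chip to each neighbor; a configuration is terminal if no non-sink vertex is full. -}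

module Defs where

open import Data.Nat as ℕ using (ℕ; zero; suc; _+_; _*_; _∸_; _≤_; _<_)
open import Data.Bool using (Bool; true; false; if_then_else_; T)
open import Data.Fin using (Fin)
open import Data.List using (List; map; allFin)
open import Data.Nat.ListAction using (sum)
open import Data.Product using (Σ; _×_; ∃)
open import Data.Integer using (+_)
open import Data.Rational as ℚ using (ℚ; _/_)
open import Relation.Binary.PropositionalEquality using (_≡_; _≢_)
open import Relation.Nullary using (¬_)
open import Data.Fin using (_≟_)
import Data.Nat.Logarithm
open import Relation.Nullary.Decidable using (⌊_⌋)

Graph : ℕ → Set
Graph n = Fin n → Fin n → Bool

IsSimple : ∀ {n} → Graph n → Set
IsSimple {n} G = (∀ u v → G u v ≡ G v u) × (∀ v → G v v ≡ false)

count : ∀ {n} → (Fin n → Bool) → ℕ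
count {n} P = sum (map (λ w → if P w then 1 else 0) (allFin n))

deg : ∀ {n} → Graph n → Fin n → ℕ
deg G v = count (G v)

IsRegular : ∀ {n} → Graph n → ℕ → Set
IsRegular {n} G d = ∀ v → deg G v ≡ d

_∨ᵇ_ : Bool → Bool → Bool
true ∨ᵇ _ = true
false ∨ᵇ b = b

notᵇ : Bool → Bool
notᵇ true = false
notᵇ false = true

anyᵇ : ∀ {n} → (Fin n → Bool) → Bool
anyᵇ {n} P = Data.List.foldr (λ w b → P w ∨ᵇ b) false (allFin n)

nbr : ∀ {n} → Graph n → (Fin n → Bool) → (Fin n → Bool)
nbr G X w = anyᵇ (λ x → if X x then G x w else false)

boundary : ∀ {n} → Graph n → (Fin n → Bool) → (Fin n → Bool)
boundary G X w = if X w then false else nbr G X w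

IsVertexExpander : ∀ {n} → ℚ → Graph n → Set
IsVertexExpander {n} ε G =
  ∀ (X : Fin n → Bool) → 2 * count X ≤ n →
    ε ℚ.* ((+ count X) / 1) ℚ.≤ ((+ count (boundary G X)) / 1)

Config : ℕ → Set
Config n = Fin n → ℕ

totalChips : ∀ {n} → Fin n → Config n → ℕ
totalChips {n} s σ = sum (map (λ w → if ⌊ w ≟ s ⌋ then 0 else σ w) (allFin n))

FloorDiv : ℕ → ℕ → ℕ → Set
FloorDiv a b k = k * b ≤ a × a < suc k * b

GreedyStep : ∀ {n} → Graph n → Fin n → Config n → Config n → Set
GreedyStep {n} G s σ σ' =
  Σ (Fin n) λ u → Σ ℕ λ k →
    u ≢ s × deg G u ≤ σ u × FloorDiv (σ u) (deg G u) k ×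
    (∀ v → v ≢ s → ∀ j → FloorDiv (σ v) (deg G v) j → j ≤ k) ×
    σ' u ≡ σ u ∸ k * deg G u ×
    (∀ w → w ≢ u → σ' w ≡
       (if G u w ∧ notᵇ ⌊ w ≟ s ⌋ then σ w + k else σ w))
  where
  _∧_ : Bool → Bool → Bool
  true ∧ b = b
  false ∧ _ = false

data GreedyRun {n} (G : Graph n) (s : Fin n) : Config n → ℕ → Set where
  stop : ∀ σ → GreedyRun G s σ 0
  step : ∀ {σ σ' m} → GreedyStep G s σ σ' → GreedyRun G s σ' m →
         GreedyRun G s σ (suc m)

-- the O(n² log n log(nN)) bound with constant C (logs made ≥ 1 by +1)
bound : ℕ → ℕ → ℕ → ℕ
bound C n N = C * (n * n) * (1 + Data.Nat.Logarithm.⌈log₂ n ⌉)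
                          * (1 + Data.Nat.Logarithm.⌈log₂ (n * N) ⌉)

{-# OPTIONS --safe #-}
-- Let F v be the number of times v fires during a stretch of the run that
-- starts with N chips. Off the sink, d F v is at most σ v plus the sum of F over
-- the neighbours of v, so F is a potential fed by N units of current. Summing
-- this inequality over a superlevel set bounds by N the total drop of F across
-- the edges leaving that set. By Markov's inequality most of the boundary lies
-- within O(N / size) of the threshold, so expansion makes the sublevel sets
-- around the sink, and the superlevel sets around any x, grow geometrically.
-- Both reach n / 2 after a drop of O(N / d): the first step absorbs half of
-- the d neighbours, and the later costs form a geometric series. The two sets
-- then meet, so F x = O(N / d) for every x.
--
-- A greedy step with multiplicity k requires at most 2 n d k chips, whence a
-- stretch on which the total stays above N / 2 has O(n²) steps, and there are
-- at most 1 + log N such stretches.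
module Submission where

open import Defs
open import Data.Nat using (ℕ; zero; suc; _+_; _*_; _∸_; _^_; _/_; _%_; _≤_; _<_; _≤?_; z≤n; s≤s; NonZero; >-nonZero)
open import Data.Nat.Properties
open import Data.Nat.DivMod using (m/n*n≤m; m≡m%n+[m/n]*n; m%n<n)
open import Data.Nat.Logarithm using (⌈log₂_⌉; ⌈log₂⌉-mono-≤; ⌈log₂2^n⌉≡n)
open import Data.Nat.Tactic.RingSolver using (solve-∀)
open import Data.Bool using (Bool; true; false; if_then_else_)
open import Data.Fin as Fin using (Fin)
open import Data.List using (List; _∷_; map; allFin; tabulate; foldr)
open import Data.List.Properties using (map-tabulate)
open import Data.Fin.Properties using (toℕ<n)
import Data.Nat.ListAction as List
open import Data.Integer as ℤ using (+_)
import Data.Integer.Properties as ℤ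
open import Data.Product using (Σ; ∃; _×_; _,_; proj₁; proj₂)
open import Data.Sum using (_⊎_; inj₁; inj₂)
open import Data.Rational as ℚ using (ℚ; Positive; mkℚ)
import Data.Rational.Properties as ℚ
open import Data.Rational.Unnormalised as ℚᵘ using (ℚᵘ; mkℚᵘ; *≤*)
import Data.Rational.Unnormalised.Properties as ℚᵘ
open import Function using (_∘_; id)
open import Relation.Nullary using (¬_; yes; no; contradiction)
open import Relation.Nullary.Decidable using (⌊_⌋)
open import Relation.Binary.PropositionalEquality
open import Algebra.Properties.Semiring.Sum +-*-semiring
  using (sum; sum-cong-≗; ∑-distrib-+; ∑-comm; *-distribˡ-sum; *-distribʳ-sum)

private
  variable
    n : ℕ

-- Finite sums, rounding and binary logarithms.

𝟙 : Bool → ℕ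
𝟙 b = if b then 1 else 0

sum-map-allFin : (f : Fin n → ℕ) → List.sum (map f (allFin n)) ≡ sum f
sum-map-allFin f = trans (cong List.sum (map-tabulate id f)) (sum-tabulate f)
  where
  sum-tabulate : ∀ {n} (f : Fin n → ℕ) → List.sum (tabulate f) ≡ sum f
  sum-tabulate {zero}  f = refl
  sum-tabulate {suc n} f = cong (λ x → f Fin.zero + x) (sum-tabulate (f ∘ Fin.suc))

count≡sum : (P : Fin n → Bool) → count P ≡ sum (𝟙 ∘ P)
count≡sum P = sum-map-allFin (𝟙 ∘ P)

sum-mono-≤ : {f g : Fin n → ℕ} → (∀ i → f i ≤ g i) → sum f ≤ sum g
sum-mono-≤ {zero}  f≤g = z≤n
sum-mono-≤ {suc n} f≤g = +-mono-≤ (f≤g Fin.zero) (sum-mono-≤ (f≤g ∘ Fin.suc))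

f≤sum : (f : Fin n → ℕ) (i : Fin n) → f i ≤ sum f
f≤sum f Fin.zero    = m≤m+n _ _
f≤sum f (Fin.suc i) = ≤-trans (f≤sum (f ∘ Fin.suc) i) (m≤n+m _ _)

sum-bound : ∀ {c} (f : Fin n → ℕ) → (∀ i → f i ≤ c) → sum f ≤ n * c
sum-bound {zero}  f f≤c = z≤n
sum-bound {suc n} f f≤c = +-mono-≤ (f≤c Fin.zero) (sum-bound (f ∘ Fin.suc) (f≤c ∘ Fin.suc))

m<[1+m/n]*n : ∀ m n .{{_ : NonZero n}} → m < suc (m / n) * n
m<[1+m/n]*n m n = begin-strict
  m                     ≡⟨ m≡m%n+[m/n]*n m n ⟩
  m % n + (m / n) * n   <⟨ +-monoˡ-< _ (m%n<n m n) ⟩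
  n + (m / n) * n       ∎
  where open ≤-Reasoning

-- Otherwise monotonicity of the logarithm gives 1 + ⌈log₂ n⌉ ≤ ⌈log₂ n⌉. The extra 1 in the
-- exponent makes the inequality strict at powers of two.
n<2^1+⌈log₂n⌉ : ∀ n → n < 2 ^ suc ⌈log₂ n ⌉
n<2^1+⌈log₂n⌉ n = ≰⇒> λ 2^≤n → 1+n≰n (begin
  suc ⌈log₂ n ⌉                   ≡⟨ ⌈log₂2^n⌉≡n _ ⟨
  ⌈log₂ (2 ^ suc ⌈log₂ n ⌉) ⌉     ≤⟨ ⌈log₂⌉-mono-≤ 2^≤n ⟩
  ⌈log₂ n ⌉                       ∎)
  where open ≤-Reasoning

-- Configurations, adjacency and sublevel sets.

chips : Fin n → Config n → Fin n → ℕ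
chips s σ v = if ⌊ v Fin.≟ s ⌋ then 0 else σ v

totalChips≡sum : ∀ (s : Fin n) σ → totalChips s σ ≡ sum (chips s σ)
totalChips≡sum s σ = sum-map-allFin (chips s σ)

adj : Graph n → Fin n → Fin n → ℕ
adj G v w = 𝟙 (G v w)

ball : (Fin n → ℕ) → ℕ → Fin n → Bool
ball g r v = ⌊ g v ≤? r ⌋

-- The number of neighbours of v in X.
degIn : Graph n → (Fin n → Bool) → Fin n → ℕ
degIn G X v = sum λ w → 𝟙 (X w) * adj G w v

-- Firing each v in total F v times leaves a nonnegative number of chips
-- outside the sink.
Fires : Graph n → ℕ → Fin n → Config n → (Fin n → ℕ) → Set
Fires G d s σ F = F s ≡ 0 × (∀ v → v ≢ s → d * F v ≤ σ v + sum λ w → adj G v w * F w)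

-- Flow of the firing potential across level sets.

module _ {d : ℕ} (G : Graph n) (G-sym : ∀ u v → G u v ≡ G v u) (reg : IsRegular G d) where

  adj-sum : ∀ v → sum (adj G v) ≡ d
  adj-sum v = trans (sym (count≡sum (G v))) (reg v)

  -- Double counting of the edges with one end in `X`, each weighted by `f` at its other end.
  degIn-swap : ∀ X (f : Fin n → ℕ) →
    sum (λ w → 𝟙 (X w) * sum λ v → adj G w v * f v) ≡ sum λ v → degIn G X v * f v
  degIn-swap X f = begin
    sum (λ w → 𝟙 (X w) * sum λ v → adj G w v * f v)
      ≡⟨ sum-cong-≗ (λ w → *-distribˡ-sum (𝟙 (X w)) (λ v → adj G w v * f v)) ⟩
    sum (λ w → sum λ v → 𝟙 (X w) * (adj G w v * f v))
      ≡⟨ ∑-comm (λ w v → 𝟙 (X w) * (adj G w v * f v)) ⟩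
    sum (λ v → sum λ w → 𝟙 (X w) * (adj G w v * f v))
      ≡⟨ sum-cong-≗ (λ v → sum-cong-≗ (λ w → sym (*-assoc (𝟙 (X w)) (adj G w v) (f v)))) ⟩
    sum (λ v → sum λ w → (𝟙 (X w) * adj G w v) * f v)
      ≡⟨ sum-cong-≗ (λ v → *-distribʳ-sum (f v) (λ w → 𝟙 (X w) * adj G w v)) ⟨
    sum (λ v → degIn G X v * f v) ∎
    where open ≡-Reasoning

  degIn-complement : ∀ X v → degIn G X v + degIn G (notᵇ ∘ X) v ≡ d
  degIn-complement X v = begin
    degIn G X v + degIn G (notᵇ ∘ X) v
      ≡⟨ ∑-distrib-+ (λ w → 𝟙 (X w) * adj G w v) (λ w → 𝟙 (notᵇ (X w)) * adj G w v) ⟨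
    sum (λ w → 𝟙 (X w) * adj G w v + 𝟙 (notᵇ (X w)) * adj G w v)
      ≡⟨ sum-cong-≗ (λ w → trans (split (X w) (adj G w v)) (cong 𝟙 (G-sym w v))) ⟩
    sum (adj G v)
      ≡⟨ adj-sum v ⟩
    d ∎
    where
    open ≡-Reasoning
    split : ∀ b a → 𝟙 b * a + 𝟙 (notᵇ b) * a ≡ a
    split true  a = trans (+-identityʳ _) (*-identityˡ a)
    split false a = *-identityˡ a

  degIn≤d : ∀ X v → degIn G X v ≤ d
  degIn≤d X v = m+n≤o⇒m≤o _ (≤-reflexive (degIn-complement X v))

  module Flow {s : Fin n} {σ : Config n} {F : Fin n → ℕ} (fires : Fires G d s σ F) where

    -- The firing inequality at `v` with `t` subtracted from every value of `F`. Differences of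
    -- either sign are split into two truncated ones, the negative parts being moved to the
    -- left-hand side.
    vertexFlow : ∀ t v → v ≢ s → t ≤ F v →
      d * (F v ∸ t) + sum (λ w → adj G v w * (t ∸ F w)) ≤
      σ v + sum (λ w → adj G v w * (F w ∸ t))
    vertexFlow t v v≢s t≤Fv = +-cancelʳ-≤ (d * t) _ _ (begin
      d * (F v ∸ t) + sum (λ w → adj G v w * (t ∸ F w)) + d * t
        ≡⟨ rearrange d (F v ∸ t) t _ ⟩
      d * (F v ∸ t + t) + sum (λ w → adj G v w * (t ∸ F w))
        ≡⟨ cong (λ x → d * x + sum (λ w → adj G v w * (t ∸ F w))) (m∸n+n≡m t≤Fv) ⟩
      d * F v + sum (λ w → adj G v w * (t ∸ F w))
        ≤⟨ +-monoˡ-≤ _ (proj₂ fires v v≢s) ⟩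
      σ v + sum (λ w → adj G v w * F w) + sum (λ w → adj G v w * (t ∸ F w))
        ≡⟨ +-assoc (σ v) _ _ ⟩
      σ v + (sum (λ w → adj G v w * F w) + sum (λ w → adj G v w * (t ∸ F w)))
        ≡⟨ cong (λ x → σ v + x) (sym (∑-distrib-+ (λ w → adj G v w * F w) (λ w → adj G v w * (t ∸ F w)))) ⟩
      σ v + sum (λ w → adj G v w * F w + adj G v w * (t ∸ F w))
        ≡⟨ cong (λ x → σ v + x) (sum-cong-≗ truncate) ⟩
      σ v + sum (λ w → adj G v w * (F w ∸ t) + adj G v w * t)
        ≡⟨ cong (λ x → σ v + x) (∑-distrib-+ (λ w → adj G v w * (F w ∸ t)) (λ w → adj G v w * t)) ⟩
      σ v + (sum (λ w → adj G v w * (F w ∸ t)) + sum (λ w → adj G v w * t))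
        ≡⟨ cong (λ x → σ v + (sum (λ w → adj G v w * (F w ∸ t)) + x)) adj-const ⟩
      σ v + (sum (λ w → adj G v w * (F w ∸ t)) + d * t)
        ≡⟨ +-assoc (σ v) _ _ ⟨
      σ v + sum (λ w → adj G v w * (F w ∸ t)) + d * t ∎)
      where
      open ≤-Reasoning
      rearrange : ∀ d x t y → d * x + y + d * t ≡ d * (x + t) + y
      rearrange = solve-∀
      -- Both sides equal the maximum of `m` and `n`.
      m+[n∸m]≡[m∸n]+n : ∀ m n → m + (n ∸ m) ≡ (m ∸ n) + n
      m+[n∸m]≡[m∸n]+n zero    n       = cong (_+ n) (sym (0∸n≡0 n))
      m+[n∸m]≡[m∸n]+n (suc m) zero    = refl
      m+[n∸m]≡[m∸n]+n (suc m) (suc n) = trans (cong suc (m+[n∸m]≡[m∸n]+n m n)) (sym (+-suc (m ∸ n) n))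
      truncate : ∀ w → adj G v w * F w + adj G v w * (t ∸ F w) ≡ adj G v w * (F w ∸ t) + adj G v w * t
      truncate w = begin-equality
        adj G v w * F w + adj G v w * (t ∸ F w)   ≡⟨ *-distribˡ-+ (adj G v w) _ _ ⟨
        adj G v w * (F w + (t ∸ F w))             ≡⟨ cong (adj G v w *_) (m+[n∸m]≡[m∸n]+n (F w) t) ⟩
        adj G v w * (F w ∸ t + t)                 ≡⟨ *-distribˡ-+ (adj G v w) _ _ ⟩
        adj G v w * (F w ∸ t) + adj G v w * t     ∎
      adj-const : sum (λ w → adj G v w * t) ≡ d * t
      adj-const = trans (sym (*-distribʳ-sum t (adj G v))) (cong (_* t) (adj-sum v))

    -- The sum of `vertexFlow` over `X`, with the edges regrouped by their far end. Edges inside `X`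
    -- are counted as well; the two applications cancel them in different ways.
    setFlow : ∀ t X → (∀ v → X v ≡ true → v ≢ s × t ≤ F v) →
      d * sum (λ v → 𝟙 (X v) * (F v ∸ t)) + sum (λ v → degIn G X v * (t ∸ F v)) ≤
      totalChips s σ + sum (λ v → degIn G X v * (F v ∸ t))
    setFlow t X X⇒ = begin
      d * sum (λ v → 𝟙 (X v) * (F v ∸ t)) + sum (λ v → degIn G X v * (t ∸ F v))
        ≡⟨ cong₂ _+_ (*-distribˡ-sum d (λ v → 𝟙 (X v) * (F v ∸ t))) (sym (degIn-swap X (λ v → t ∸ F v))) ⟩
      sum (λ v → d * (𝟙 (X v) * (F v ∸ t))) + sum (λ v → 𝟙 (X v) * inψ v)
        ≡⟨ ∑-distrib-+ (λ v → d * (𝟙 (X v) * (F v ∸ t))) (λ v → 𝟙 (X v) * inψ v) ⟨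
      sum (λ v → d * (𝟙 (X v) * (F v ∸ t)) + 𝟙 (X v) * inψ v)
        ≤⟨ sum-mono-≤ pointwise ⟩
      sum (λ v → chips s σ v + 𝟙 (X v) * inφ v)
        ≡⟨ ∑-distrib-+ (chips s σ) (λ v → 𝟙 (X v) * inφ v) ⟩
      sum (chips s σ) + sum (λ v → 𝟙 (X v) * inφ v)
        ≡⟨ cong₂ _+_ (sym (totalChips≡sum s σ)) (degIn-swap X (λ v → F v ∸ t)) ⟩
      totalChips s σ + sum (λ v → degIn G X v * (F v ∸ t)) ∎
      where
      open ≤-Reasoning
      inφ inψ : Fin n → ℕ
      inφ v = sum λ w → adj G v w * (F w ∸ t)
      inψ v = sum λ w → adj G v w * (t ∸ F w)
      pointwise : ∀ v → d * (𝟙 (X v) * (F v ∸ t)) + 𝟙 (X v) * inψ v ≤ chips s σ v + 𝟙 (X v) * inφ v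
      pointwise v with X v in Xv
      ... | false = subst (_≤ chips s σ v + 0) (sym (trans (+-identityʳ _) (*-zeroʳ d))) z≤n
      ... | true with v Fin.≟ s
      ...   | yes v≡s = contradiction v≡s (proj₁ (X⇒ v Xv))
      ...   | no  v≢s = subst₂ _≤_
                          (cong₂ (λ x y → d * x + y) (sym (*-identityˡ _)) (sym (*-identityˡ _)))
                          (cong (λ x → σ v + x) (sym (*-identityˡ _)))
                          (vertexFlow t v v≢s (proj₂ (X⇒ v Xv)))

-- The edges leaving the sublevel set at `r`, each weighted by how far its outer end exceeds `r`,
-- have total weight at most `N`. This one condition drives the growth both of the sets around the
-- sink and of those around `x`.
Gentle : Graph n → ℕ → (Fin n → ℕ) → Set
Gentle G N g = ∀ r → sum (λ v → degIn G (ball g r) v * (g v ∸ r)) ≤ N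

module _ {d : ℕ} {G : Graph n} (G-sym : ∀ u v → G u v ≡ G v u) (reg : IsRegular G d)
         {s : Fin n} {σ : Config n} {F : Fin n → ℕ} (fires : Fires G d s σ F) where

  open Flow G G-sym reg fires

  -- Apply `setFlow` to the complement `X` of the ball. A vertex of `X` has `d` neighbours in all,
  -- so cancelling those in `X` from the term with factor `d` leaves exactly those in the ball.
  firings-gentle : Gentle G (totalChips s σ) F
  firings-gentle r = +-cancelˡ-≤ inX _ _ (begin
    inX + sum (λ v → degIn G B v * (F v ∸ r))
      ≡⟨ ∑-distrib-+ (λ v → degIn G X v * (F v ∸ r)) (λ v → degIn G B v * (F v ∸ r)) ⟨
    sum (λ v → degIn G X v * (F v ∸ r) + degIn G B v * (F v ∸ r))
      ≡⟨ sum-cong-≗ pointwise ⟩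
    sum (λ v → d * (𝟙 (X v) * (F v ∸ r)))
      ≡⟨ *-distribˡ-sum d (λ v → 𝟙 (X v) * (F v ∸ r)) ⟨
    d * sum (λ v → 𝟙 (X v) * (F v ∸ r))
      ≤⟨ m≤m+n _ _ ⟩
    d * sum (λ v → 𝟙 (X v) * (F v ∸ r)) + sum (λ v → degIn G X v * (r ∸ F v))
      ≤⟨ setFlow r X X⇒ ⟩
    totalChips s σ + inX
      ≡⟨ +-comm (totalChips s σ) inX ⟩
    inX + totalChips s σ ∎)
    where
    open ≤-Reasoning
    B X : Fin n → Bool
    B = ball F r
    X = notᵇ ∘ B
    inX : ℕ
    inX = sum λ v → degIn G X v * (F v ∸ r)
    X⇒ : ∀ v → X v ≡ true → v ≢ s × r ≤ F v
    X⇒ v Xv with F v ≤? r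
    ... | no r≱Fv = (λ { refl → r≱Fv (subst (_≤ r) (sym (proj₁ fires)) z≤n) }) , <⇒≤ (≰⇒> r≱Fv)
    off-ball : ∀ v → F v ∸ r ≡ 𝟙 (X v) * (F v ∸ r)
    off-ball v with F v ≤? r
    ... | yes Fv≤r = m≤n⇒m∸n≡0 Fv≤r
    ... | no  _    = sym (*-identityˡ _)
    pointwise : ∀ v → degIn G X v * (F v ∸ r) + degIn G B v * (F v ∸ r) ≡ d * (𝟙 (X v) * (F v ∸ r))
    pointwise v = begin-equality
      degIn G X v * (F v ∸ r) + degIn G B v * (F v ∸ r)  ≡⟨ *-distribʳ-+ (F v ∸ r) (degIn G X v) (degIn G B v) ⟨
      (degIn G X v + degIn G B v) * (F v ∸ r)            ≡⟨ cong (_* (F v ∸ r)) (trans (+-comm (degIn G X v) _) (degIn-complement G G-sym reg B v)) ⟩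
      d * (F v ∸ r)                                      ≡⟨ cong (d *_) (off-ball v) ⟩
      d * (𝟙 (X v) * (F v ∸ r))                          ∎

  -- The balls of `c ∸ F` are superlevel sets of `F`, so `setFlow` applies to the ball itself. Since
  -- `degIn` is at most `d`, the term `d * inside` pays for the upward differences, and the downward
  -- ones remain.
  deficits-gentle : ∀ c → Gentle G (totalChips s σ) (λ v → c ∸ F v)
  deficits-gentle c r with c ≤? r
  ... | yes c≤r = ≤-trans (sum-bound _ zero-term) (≤-trans (≤-reflexive (*-zeroʳ n)) z≤n)
    where
    zero-term : ∀ v → degIn G (ball (λ v → c ∸ F v) r) v * (c ∸ F v ∸ r) ≤ 0
    zero-term v = ≤-reflexive (trans
      (cong (degIn G (ball (λ v → c ∸ F v) r) v *_) (m≤n⇒m∸n≡0 (≤-trans (m∸n≤m c (F v)) c≤r)))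
      (*-zeroʳ (degIn G (ball (λ v → c ∸ F v) r) v)))
  ... | no c≰r = +-cancelˡ-≤ (d * inside) _ _ (begin
    d * inside + sum (λ v → degIn G X v * (c ∸ F v ∸ r))
      ≡⟨ cong (λ x → d * inside + x) (sum-cong-≗ (λ v → cong (degIn G X v *_) (∸-∸-comm v))) ⟩
    d * inside + sum (λ v → degIn G X v * (t ∸ F v))
      ≤⟨ setFlow t X X⇒ ⟩
    totalChips s σ + sum (λ v → degIn G X v * (F v ∸ t))
      ≤⟨ +-monoʳ-≤ (totalChips s σ) (sum-mono-≤ pointwise) ⟩
    totalChips s σ + sum (λ v → d * (𝟙 (X v) * (F v ∸ t)))
      ≡⟨ cong (λ x → totalChips s σ + x) (sym (*-distribˡ-sum d (λ v → 𝟙 (X v) * (F v ∸ t)))) ⟩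
    totalChips s σ + d * inside
      ≡⟨ +-comm (totalChips s σ) _ ⟩
    d * inside + totalChips s σ ∎)
    where
    open ≤-Reasoning
    t = c ∸ r
    X = ball (λ v → c ∸ F v) r
    inside = sum λ v → 𝟙 (X v) * (F v ∸ t)
    ∸-∸-comm : ∀ v → c ∸ F v ∸ r ≡ t ∸ F v
    ∸-∸-comm v = trans (∸-+-assoc c (F v) r) (trans (cong (c ∸_) (+-comm (F v) r)) (sym (∸-+-assoc c r (F v))))
    t≤F : ∀ v → c ∸ F v ≤ r → t ≤ F v
    t≤F v p = m≤n+o⇒m∸n≤o c r (≤-trans (m≤n+m∸n c (F v)) (≤-trans (+-monoʳ-≤ (F v) p) (≤-reflexive (+-comm (F v) r))))
    X⇒ : ∀ v → X v ≡ true → v ≢ s × t ≤ F v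
    X⇒ v Xv with c ∸ F v ≤? r
    -- The sink never fires, so its deficit is `c`, which exceeds `r`.
    ... | yes p = (λ { refl → c≰r (subst (λ x → c ∸ x ≤ r) (proj₁ fires) p) }) , t≤F v p
    pointwise : ∀ v → degIn G X v * (F v ∸ t) ≤ d * (𝟙 (X v) * (F v ∸ t))
    pointwise v = ≤-trans (*-monoˡ-≤ (F v ∸ t) (degIn≤d G G-sym reg X v)) (*-monoʳ-≤ d in-X)
      where
      in-X : F v ∸ t ≤ 𝟙 (X v) * (F v ∸ t)
      in-X with c ∸ F v ≤? r
      ... | yes _ = ≤-reflexive (sym (*-identityˡ _))
      ... | no  p = ≤-reflexive (m≤n⇒m∸n≡0 {F v} {t} (≮⇒≥ λ t<F → p (begin
        c ∸ F v         ≤⟨ ∸-monoʳ-≤ c (<⇒≤ t<F) ⟩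
        c ∸ (c ∸ r)     ≡⟨ m∸[m∸n]≡n (<⇒≤ (≰⇒> c≰r)) ⟩
        r               ∎)))


-- Geometric growth of balls in an expander.

nbr⇒∃ : (G : Graph n) (X : Fin n → Bool) (w : Fin n) →
  nbr G X w ≡ true → ∃ λ v → X v ≡ true × G v w ≡ true
nbr⇒∃ {n} G X w = go (allFin n)
  where
  go : ∀ vs → foldr (λ v b → (if X v then G v w else false) ∨ᵇ b) false vs ≡ true →
       ∃ λ v → X v ≡ true × G v w ≡ true
  go (v ∷ vs) p with X v in Xv | G v w in Gvw
  ... | true  | true  = v , Xv , Gvw
  ... | true  | false = go vs p
  ... | false | _     = go vs p

degIn-positive : (G : Graph n) (X : Fin n → Bool) {v w : Fin n} →
  X v ≡ true → G v w ≡ true → 1 ≤ degIn G X w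
degIn-positive G X {v} {w} Xv Gvw =
  ≤-trans (≤-reflexive (sym (cong₂ (λ a b → 𝟙 a * 𝟙 b) Xv Gvw))) (f≤sum (λ u → 𝟙 (X u) * adj G u w) v)

-- Vertex expansion with constant 1/q, cleared of division.
Expands : ℕ → Graph n → Set
Expands {n} q G = ∀ X → 2 * count X ≤ n → count X ≤ q * count (boundary G X)

-- An advance from a ball of size b costs at most 2qN/b, and sizes grow by the ratio (2q + 1)/(2q).
-- The geometric series sums to 2q(2q + 1) N/b, with b the initial size.
growthCost : ℕ → ℕ
growthCost q = 2 * q * (2 * q + 1)

module Growth {d q N : ℕ} {G : Graph n} (reg : IsRegular G d) (expands : Expands q G)
              {g : Fin n → ℕ} {x : Fin n} (gx≡0 : g x ≡ 0) (gentle : Gentle G N g) where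

  open ≤-Reasoning

  size : ℕ → ℕ
  size r = count (ball g r)

  cost : ℕ
  cost = growthCost q

  -- A vertex of P escaping the larger ball contributes more than δ to the
  -- gentleness sum of the smaller one.
  absorb : ∀ r δ (P : Fin n → Bool) → (∀ w → P w ≡ true → g w ≤ r ⊎ 1 ≤ degIn G (ball g r) w) →
    ∃ λ c → c * suc δ ≤ N × count P ≤ size (r + δ) + c
  absorb r δ P P⇒ = sum far , few , (begin
    count P                                      ≡⟨ count≡sum P ⟩
    sum (𝟙 ∘ P)                                  ≤⟨ sum-mono-≤ covered ⟩
    sum (λ w → 𝟙 (ball g (r + δ) w) + far w)     ≡⟨ ∑-distrib-+ (𝟙 ∘ ball g (r + δ)) far ⟩
    sum (𝟙 ∘ ball g (r + δ)) + sum far           ≡⟨ cong (_+ sum far) (count≡sum (ball g (r + δ))) ⟨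
    size (r + δ) + sum far                       ∎)
    where
    far : Fin n → ℕ
    far w = 𝟙 (P w) * 𝟙 (notᵇ (ball g (r + δ) w))
    covered : ∀ w → 𝟙 (P w) ≤ 𝟙 (ball g (r + δ) w) + far w
    covered w with P w | g w ≤? r + δ
    ... | false | _     = z≤n
    ... | true  | yes _ = ≤-refl
    ... | true  | no  _ = ≤-refl
    pays : ∀ w → far w * suc δ ≤ degIn G (ball g r) w * (g w ∸ r)
    pays w with P w in Pw | g w ≤? r + δ
    ... | false | _     = z≤n
    ... | true  | yes _ = z≤n
    ... | true  | no r+δ≱gw with P⇒ w Pw
    ...   | inj₁ gw≤r  = contradiction (≤-trans gw≤r (m≤m+n r δ)) r+δ≱gw
    ...   | inj₂ 1≤deg = *-mono-≤ 1≤deg (m+n≤o⇒m≤o∸n (suc δ) (subst (_≤ g w) (cong suc (+-comm r δ)) (≰⇒> r+δ≱gw)))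
    few : sum far * suc δ ≤ N
    few = begin
      sum far * suc δ                                      ≡⟨ *-distribʳ-sum (suc δ) far ⟩
      sum (λ w → far w * suc δ)                            ≤⟨ sum-mono-≤ pays ⟩
      sum (λ w → degIn G (ball g r) w * (g w ∸ r))         ≤⟨ gentle r ⟩
      N                                                    ∎

  -- Turns the choice δ = ⌊aN/b⌋ into the statement that the number `c` of escaping vertices is
  -- below b/a.
  scarce : ∀ a b c δ → c * suc δ ≤ N → a * N < suc δ * b → a * c < b
  scarce a b c δ cδ≤N aN<δb = *-cancelˡ-< (suc δ) (a * c) b (begin-strict
    suc δ * (a * c)   ≡⟨ rearrange (suc δ) a c ⟩
    a * (c * suc δ)   ≤⟨ *-monoʳ-≤ a cδ≤N ⟩
    a * N             <⟨ aN<δb ⟩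
    suc δ * b         ∎)
    where
    rearrange : ∀ e a c → e * (a * c) ≡ a * (c * e)
    rearrange = solve-∀

  -- All `d` neighbours of `x` touch the ball of radius 0, and with δ = ⌊2N/d⌋ fewer than half of
  -- them escape. Starting the growth from size d/2 is what brings the final radius down to O(N/d).
  neighbourhood : 0 < d → ∃ λ r → d * r ≤ 2 * N × d ≤ 2 * size r
  neighbourhood d>0 = enclose (absorb 0 δ (G x) (λ w Gxw → inj₂ (degIn-positive G (ball g 0) x∈ball Gxw)))
    where
    instance _ = >-nonZero d>0
    δ : ℕ
    δ = (2 * N) / d
    x∈ball : ball g 0 x ≡ true
    x∈ball rewrite gx≡0 = refl
    enclose : (∃ λ c → c * suc δ ≤ N × count (G x) ≤ size δ + c) →
      ∃ λ r → d * r ≤ 2 * N × d ≤ 2 * size r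
    enclose (c , cδ≤N , deg≤) = δ , subst (_≤ 2 * N) (*-comm δ d) (m/n*n≤m (2 * N) d) ,
      +-cancelʳ-≤ d d (2 * size δ) (begin
        d + d                  ≡⟨ cong (λ y → d + y) (+-identityʳ d) ⟨
        2 * d                  ≡⟨ cong (2 *_) (reg x) ⟨
        2 * deg G x            ≤⟨ *-monoʳ-≤ 2 deg≤ ⟩
        2 * (size δ + c)       ≡⟨ *-distribˡ-+ 2 (size δ) c ⟩
        2 * size δ + 2 * c     ≤⟨ +-monoʳ-≤ (2 * size δ) (<⇒≤ (scarce 2 d c δ cδ≤N (m<[1+m/n]*n (2 * N) d))) ⟩
        2 * size δ + d         ∎)

  -- The ball together with its boundary has at least (1 + 1/q) b vertices. With δ = ⌊2qN/b⌋ fewer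
  -- than b/(2q) of them escape, so half of the gain survives.
  advance : ∀ r → 0 < size r → 2 * size r ≤ n →
    ∃ λ δ → size r * δ ≤ 2 * q * N × (2 * q + 1) * size r ≤ 2 * q * size (r + δ)
  advance r b>0 2b≤n = step-from (absorb r δ (λ w → B w ∨ᵇ ∂ w) reachable)
    where
    instance _ = >-nonZero b>0
    B ∂ : Fin n → Bool
    B = ball g r
    ∂ = boundary G B
    b δ : ℕ
    b = size r
    δ = (2 * q * N) / b
    reachable : ∀ w → (B w ∨ᵇ ∂ w) ≡ true → g w ≤ r ⊎ 1 ≤ degIn G B w
    reachable w p with g w ≤? r
    ... | yes gw≤r = inj₁ gw≤r
    ... | no  _ with nbr⇒∃ G B w p
    ...   | v , Bv , Gvw = inj₂ (degIn-positive G B Bv Gvw)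
    disjoint : ∀ w → 𝟙 (B w) + 𝟙 (∂ w) ≡ 𝟙 (B w ∨ᵇ ∂ w)
    disjoint w with g w ≤? r
    ... | yes _ = refl
    ... | no  _ = refl
    count-∪ : b + count ∂ ≡ count (λ w → B w ∨ᵇ ∂ w)
    count-∪ = begin-equality
      b + count ∂                         ≡⟨ cong₂ _+_ (count≡sum B) (count≡sum ∂) ⟩
      sum (𝟙 ∘ B) + sum (𝟙 ∘ ∂)           ≡⟨ ∑-distrib-+ (𝟙 ∘ B) (𝟙 ∘ ∂) ⟨
      sum (λ w → 𝟙 (B w) + 𝟙 (∂ w))       ≡⟨ sum-cong-≗ disjoint ⟩
      sum (λ w → 𝟙 (B w ∨ᵇ ∂ w))          ≡⟨ count≡sum (λ w → B w ∨ᵇ ∂ w) ⟨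
      count (λ w → B w ∨ᵇ ∂ w)            ∎
    regroup₁ : ∀ q b → (2 * q + 1) * b + b ≡ 2 * q * b + 2 * b
    regroup₁ = solve-∀
    regroup₂ : ∀ q b e → 2 * q * b + 2 * (q * e) ≡ 2 * q * (b + e)
    regroup₂ = solve-∀
    step-from : (∃ λ c → c * suc δ ≤ N × count (λ w → B w ∨ᵇ ∂ w) ≤ size (r + δ) + c) →
      ∃ λ δ → b * δ ≤ 2 * q * N × (2 * q + 1) * b ≤ 2 * q * size (r + δ)
    step-from (c , cδ≤N , ∪≤) = δ , subst (_≤ 2 * q * N) (*-comm δ b) (m/n*n≤m (2 * q * N) b) ,
      +-cancelʳ-≤ (2 * q * c) _ _ (begin
        (2 * q + 1) * b + 2 * q * c               ≤⟨ +-monoʳ-≤ ((2 * q + 1) * b) (<⇒≤ (scarce (2 * q) b c δ cδ≤N (m<[1+m/n]*n (2 * q * N) b))) ⟩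
        (2 * q + 1) * b + b                       ≡⟨ regroup₁ q b ⟩
        2 * q * b + 2 * b                         ≤⟨ +-monoʳ-≤ (2 * q * b) (*-monoʳ-≤ 2 (expands B 2b≤n)) ⟩
        2 * q * b + 2 * (q * count ∂)             ≡⟨ regroup₂ q b (count ∂) ⟩
        2 * q * (b + count ∂)                     ≡⟨ cong (2 * q *_) count-∪ ⟩
        2 * q * count (λ w → B w ∨ᵇ ∂ w)          ≤⟨ *-monoʳ-≤ (2 * q) ∪≤ ⟩
        2 * q * (size (r + δ) + c)                ≡⟨ *-distribˡ-+ (2 * q) (size (r + δ)) c ⟩
        2 * q * size (r + δ) + 2 * q * c          ∎)

  -- The radii added by successive advances form a geometric series, since the
  -- size grows by the factor 1 + 1/(2q); the factor size r in the claim lets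
  -- the induction sum that series.
  grow : ∀ k r → n ≤ k + size r → 0 < size r →
    ∃ λ y → size r * y ≤ cost * N × n < 2 * size (r + y)
  grow k r n≤ b>0 with 2 * size r ≤? n
  ... | no 2b≰n = 0 , subst (_≤ cost * N) (sym (*-zeroʳ (size r))) z≤n ,
                  subst (λ x → n < 2 * size x) (sym (+-identityʳ r)) (≰⇒> 2b≰n)
  -- The counter `k` bounds the number of vertices outside the ball, and each advance adds at least
  -- one vertex. At zero the ball is the whole graph.
  grow zero r n≤b b>0 | yes 2b≤n = contradiction 2b≤n (<⇒≱ (begin-strict
    n                    ≤⟨ n≤b ⟩
    size r               <⟨ m<m+n (size r) (<-≤-trans b>0 (m≤m+n _ 0)) ⟩
    2 * size r           ∎))
  grow (suc k) r n≤ b>0 | yes 2b≤n with advance r b>0 2b≤n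
  ... | δ , bδ≤ , growth = continue (grow k (r + δ) n≤′ (<-trans b>0 b<b′))
    where
    b b′ : ℕ
    b  = size r
    b′ = size (r + δ)
    b<b′ : b < b′
    b<b′ = *-cancelˡ-< (2 * q) b b′ (begin-strict
      2 * q * b           <⟨ m<m+n (2 * q * b) (<-≤-trans b>0 (m≤m+n b 0)) ⟩
      2 * q * b + 1 * b   ≡⟨ *-distribʳ-+ b (2 * q) 1 ⟨
      (2 * q + 1) * b     ≤⟨ growth ⟩
      2 * q * b′          ∎)
    n≤′ : n ≤ k + b′
    n≤′ = ≤-trans n≤ (subst (_≤ k + b′) (+-suc k b) (+-monoʳ-≤ k b<b′))
    expand : ∀ q b δ y → (2 * q + 1) * (b * (δ + y)) ≡ (2 * q + 1) * (b * δ) + (2 * q + 1) * b * y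
    expand = solve-∀
    collect : ∀ q M → (2 * q + 1) * (2 * q * M) + 2 * q * (2 * q * (2 * q + 1) * M) ≡
                      (2 * q + 1) * (2 * q * (2 * q + 1) * M)
    collect = solve-∀
    continue : (∃ λ y → b′ * y ≤ cost * N × n < 2 * size (r + δ + y)) →
      ∃ λ y → b * y ≤ cost * N × n < 2 * size (r + y)
    continue (y , b′y≤ , large) = δ + y ,
      *-cancelˡ-≤ (2 * q + 1) {{>-nonZero (m≤n+m 1 (2 * q))}} (begin
        (2 * q + 1) * (b * (δ + y))                          ≡⟨ expand q b δ y ⟩
        (2 * q + 1) * (b * δ) + (2 * q + 1) * b * y          ≤⟨ +-mono-≤ (*-monoʳ-≤ (2 * q + 1) bδ≤) (*-monoˡ-≤ y growth) ⟩
        (2 * q + 1) * (2 * q * N) + 2 * q * b′ * y           ≡⟨ cong (λ z → (2 * q + 1) * (2 * q * N) + z) (*-assoc (2 * q) b′ y) ⟩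
        (2 * q + 1) * (2 * q * N) + 2 * q * (b′ * y)         ≤⟨ +-monoʳ-≤ ((2 * q + 1) * (2 * q * N)) (*-monoʳ-≤ (2 * q) b′y≤) ⟩
        (2 * q + 1) * (2 * q * N) + 2 * q * (cost * N)       ≡⟨ collect q N ⟩
        (2 * q + 1) * (cost * N)                             ∎) ,
      subst (λ z → n < 2 * size z) (+-assoc r δ y) large

  -- The ball from `neighbourhood` has at least d/2 vertices, so the bound on `size r * y` from
  -- `grow` becomes one on `d * y` at the price of a factor 2.
  majority : 0 < d → ∃ λ r → d * r ≤ (2 + 2 * cost) * N × n < 2 * size r
  majority d>0 with neighbourhood d>0
  ... | r , dr≤ , d≤2b with grow n r (m≤m+n n _) (*-cancelˡ-< 2 0 (size r) (<-≤-trans d>0 d≤2b))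
  ...   | y , by≤ , large = r + y , (begin
    d * (r + y)                      ≡⟨ *-distribˡ-+ d r y ⟩
    d * r + d * y                    ≤⟨ +-mono-≤ dr≤ (*-monoˡ-≤ y d≤2b) ⟩
    2 * N + 2 * size r * y           ≡⟨ cong (λ z → 2 * N + z) (*-assoc 2 (size r) y) ⟩
    2 * N + 2 * (size r * y)         ≤⟨ +-monoʳ-≤ (2 * N) (*-monoʳ-≤ 2 by≤) ⟩
    2 * N + 2 * (cost * N)           ≡⟨ cong (λ z → 2 * N + z) (*-assoc 2 cost N) ⟨
    2 * N + 2 * cost * N             ≡⟨ *-distribʳ-+ N 2 (2 * cost) ⟨
    (2 + 2 * cost) * N               ∎) , large

-- Bound on the number of firings of each vertex.

radiusConst : ℕ → ℕ
radiusConst q = 2 + 2 * growthCost q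

module _ {d q : ℕ} {G : Graph n} (G-sym : ∀ u v → G u v ≡ G v u) (reg : IsRegular G d)
         (expands : Expands q G) (s : Fin n) where

  open ≤-Reasoning

  -- A majority has `F` at most `r`, and a majority has deficit from `F x` at most `r′`. A common
  -- vertex gives F x ≤ r + r′.
  firings-bound : 0 < d → ∀ {σ F} → Fires G d s σ F → ∀ x →
    d * F x ≤ 2 * (radiusConst q * totalChips s σ)
  firings-bound d>0 {σ} {F} fires x = meet
    (Growth.majority {q = q} reg expands {x = s} (proj₁ fires) (firings-gentle G-sym reg fires) d>0)
    (Growth.majority {q = q} reg expands {x = x} (n∸n≡0 (F x)) (deficits-gentle G-sym reg fires (F x)) d>0)
    where
    N K : ℕ
    N = totalChips s σ
    K = radiusConst q
    deficit : Fin n → ℕ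
    deficit v = F x ∸ F v
    meet : (∃ λ r → d * r ≤ K * N × n < 2 * count (ball F r)) →
           (∃ λ r → d * r ≤ K * N × n < 2 * count (ball deficit r)) →
           d * F x ≤ 2 * (K * N)
    meet (r , dr≤ , n<2b) (r′ , dr′≤ , n<2b′) = begin
      d * F x              ≤⟨ *-monoʳ-≤ d (≮⇒≥ radii-cover) ⟩
      d * (r + r′)         ≡⟨ *-distribˡ-+ d r r′ ⟩
      d * r + d * r′       ≤⟨ +-mono-≤ dr≤ dr′≤ ⟩
      K * N + K * N        ≡⟨ cong (λ z → K * N + z) (+-identityʳ (K * N)) ⟨
      2 * (K * N)          ∎
      where
      radii-cover : ¬ (r + r′ < F x)
      radii-cover r+r′<Fx = <-irrefl refl (begin-strict
        2 * n                                                      ≡⟨ cong (λ z → n + z) (+-identityʳ n) ⟩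
        n + n                                                      <⟨ +-mono-< n<2b n<2b′ ⟩
        2 * count (ball F r) + 2 * count (ball deficit r′)         ≡⟨ *-distribˡ-+ 2 (count (ball F r)) _ ⟨
        2 * (count (ball F r) + count (ball deficit r′))           ≡⟨ cong (2 *_) (cong₂ _+_ (count≡sum (ball F r)) (count≡sum (ball deficit r′))) ⟩
        2 * (sum (𝟙 ∘ ball F r) + sum (𝟙 ∘ ball deficit r′))       ≡⟨ cong (2 *_) (∑-distrib-+ (𝟙 ∘ ball F r) (𝟙 ∘ ball deficit r′)) ⟨
        2 * sum (λ v → 𝟙 (ball F r v) + 𝟙 (ball deficit r′ v))     ≤⟨ *-monoʳ-≤ 2 (sum-bound _ exclusive) ⟩
        2 * (n * 1)                                                ≡⟨ cong (2 *_) (*-identityʳ n) ⟩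
        2 * n                                                      ∎)
        where
        exclusive : ∀ v → 𝟙 (ball F r v) + 𝟙 (ball deficit r′ v) ≤ 1
        exclusive v with F v ≤? r | F x ∸ F v ≤? r′
        ... | yes Fv≤r | yes Fx∸Fv≤r′ = contradiction
              (≤-trans (m≤n+m∸n (F x) (F v)) (+-mono-≤ Fv≤r Fx∸Fv≤r′)) (<⇒≱ r+r′<Fx)
        ... | yes _    | no  _        = ≤-refl
        ... | no  _    | yes _        = ≤-refl
        ... | no  _    | no  _        = z≤n

  -- Chips moved by a single greedy step.

  burst : Fin n → ℕ → Fin n → ℕ
  burst u k v = if ⌊ v Fin.≟ u ⌋ then k else 0

  burst-at : ∀ u k → burst u k u ≡ k
  burst-at u k with u Fin.≟ u
  ... | yes _   = refl
  ... | no  u≢u = contradiction refl u≢u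

  firer : ∀ {σ σ′} → GreedyStep G s σ σ′ → Fin n
  firer = proj₁

  multiplicity : ∀ {σ σ′} → GreedyStep G s σ σ′ → ℕ
  multiplicity = proj₁ ∘ proj₂

  -- For degree 0 the strict half of `FloorDiv` would read σ u < 0.
  step-d>0 : ∀ {σ σ′} → GreedyStep G s σ σ′ → 0 < d
  step-d>0 {σ} (u , k , _ , _ , (_ , σu<) , _) = n≢0⇒n>0 λ { refl →
    contradiction (subst (λ z → σ u < suc k * z) (reg u) σu<) (λ σu<0 → n≮0 (subst (σ u <_) (*-zeroʳ (suc k)) σu<0)) }

  step-totalChips>0 : ∀ {σ σ′} → GreedyStep G s σ σ′ → 0 < totalChips s σ
  step-totalChips>0 {σ} st@(u , _ , u≢s , d≤σu , _) = begin-strict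
    0                  <⟨ step-d>0 st ⟩
    d                  ≡⟨ reg u ⟨
    deg G u            ≤⟨ d≤σu ⟩
    σ u                ≡⟨ chips-u ⟨
    chips s σ u          ≤⟨ f≤sum (chips s σ) u ⟩
    sum (chips s σ)      ≡⟨ totalChips≡sum s σ ⟨
    totalChips s σ     ∎
    where
    chips-u : chips s σ u ≡ σ u
    chips-u with u Fin.≟ s
    ... | yes u≡s = contradiction u≡s u≢s
    ... | no  _   = refl

  -- By maximality of `k` every non-sink vertex holds fewer than (k + 1) d chips. The chosen vertex
  -- is full, so k ≥ 1 and this is at most 2kd.
  step-totalChips≤ : ∀ {σ σ′} (st : GreedyStep G s σ σ′) →
    totalChips s σ ≤ 2 * n * (d * multiplicity st)
  step-totalChips≤ {σ} st@(u , k , _ , d≤σu , (_ , σu<) , maximal , _) = begin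
    totalChips s σ        ≡⟨ totalChips≡sum s σ ⟩
    sum (chips s σ)         ≤⟨ sum-bound (chips s σ) chips≤ ⟩
    n * (2 * (d * k))     ≡⟨ rearrange n d k ⟩
    2 * n * (d * k)       ∎
    where
    instance _ = >-nonZero (step-d>0 st)
    rearrange : ∀ n d k → n * (2 * (d * k)) ≡ 2 * n * (d * k)
    rearrange = solve-∀
    k>0 : 0 < k
    k>0 = n≢0⇒n>0 λ { refl → <⇒≱ σu< (≤-trans (≤-reflexive (*-identityˡ _)) d≤σu) }
    floor : ∀ v → FloorDiv (σ v) (deg G v) (σ v / d)
    floor v rewrite reg v = m/n*n≤m (σ v) d , m<[1+m/n]*n (σ v) d
    chips≤ : ∀ v → chips s σ v ≤ 2 * (d * k)
    chips≤ v with v Fin.≟ s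
    ... | yes _   = z≤n
    ... | no  v≢s = begin
      σ v                     ≤⟨ <⇒≤ (m<[1+m/n]*n (σ v) d) ⟩
      suc (σ v / d) * d       ≤⟨ *-monoˡ-≤ d (s≤s (maximal v v≢s (σ v / d) (floor v))) ⟩
      suc k * d               ≤⟨ *-monoˡ-≤ d (+-monoˡ-≤ k k>0) ⟩
      (k + k) * d             ≡⟨ double k d ⟩
      2 * (d * k)             ∎
      where
      double : ∀ k d → (k + k) * d ≡ 2 * (d * k)
      double = solve-∀

  step-balance : ∀ {σ σ′} (st : GreedyStep G s σ σ′) v → v ≢ s →
    σ′ v + d * burst (firer st) (multiplicity st) v ≤ σ v + adj G v (firer st) * multiplicity st
  step-balance {σ} {σ′} (u , k , _ , _ , (kd≤σu , _) , _ , σ′u , σ′w) v v≢s with v Fin.≟ u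
  ... | yes refl = begin
    σ′ u + d * k                 ≡⟨ cong₂ _+_ σ′u (trans (*-comm d k) (cong (k *_) (sym (reg u)))) ⟩
    σ u ∸ k * deg G u + k * deg G u     ≡⟨ m∸n+n≡m kd≤σu ⟩
    σ u                          ≤⟨ m≤m+n (σ u) _ ⟩
    σ u + adj G u u * k          ∎
  ... | no v≢u = begin
    σ′ v + d * 0                 ≡⟨ cong (λ z → σ′ v + z) (*-zeroʳ d) ⟩
    σ′ v + 0                     ≡⟨ +-identityʳ (σ′ v) ⟩
    σ′ v                         ≤⟨ received ⟩
    σ v + adj G v u * k          ∎
    where
    received : σ′ v ≤ σ v + adj G v u * k
    received rewrite G-sym v u with G u v | v Fin.≟ s | σ′w v v≢u
    ... | false | _       | eq = ≤-trans (≤-reflexive eq) (m≤m+n (σ v) 0)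
    ... | true  | yes v≡s | _  = contradiction v≡s v≢s
    ... | true  | no  _   | eq = ≤-reflexive (trans eq (cong (λ z → σ v + z) (sym (*-identityˡ k))))

  -- Adding the balance of the step to the inequality for the rest of the run cancels `σ′ v`. The
  -- firing counts of a stretch are thus accumulated from its end backwards.
  step-fires : ∀ {σ σ′} (st : GreedyStep G s σ σ′) {F} → Fires G d s σ′ F →
    Fires G d s σ (λ v → burst (firer st) (multiplicity st) v + F v)
  step-fires {σ} {σ′} st@(u , k , u≢s , _) {F} (Fs≡0 , fires) = at-sink , λ v v≢s → begin
    d * (burst u k v + F v)
      ≡⟨ *-distribˡ-+ d (burst u k v) (F v) ⟩
    d * burst u k v + d * F v
      ≤⟨ +-monoʳ-≤ (d * burst u k v) (fires v v≢s) ⟩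
    d * burst u k v + (σ′ v + sum (λ w → adj G v w * F w))
      ≡⟨ trans (sym (+-assoc (d * burst u k v) (σ′ v) _)) (cong (_+ sum (λ w → adj G v w * F w)) (+-comm _ (σ′ v))) ⟩
    σ′ v + d * burst u k v + sum (λ w → adj G v w * F w)
      ≤⟨ +-monoˡ-≤ _ (step-balance st v v≢s) ⟩
    σ v + adj G v u * k + sum (λ w → adj G v w * F w)
      ≡⟨ +-assoc (σ v) _ _ ⟩
    σ v + (adj G v u * k + sum (λ w → adj G v w * F w))
      -- The chips received from `u` are the single term w = u of the sum over the burst.
      ≤⟨ +-monoʳ-≤ (σ v) (+-monoˡ-≤ _ (≤-trans (≤-reflexive (cong (adj G v u *_) (sym (burst-at u k)))) (f≤sum (λ w → adj G v w * burst u k w) u))) ⟩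
    σ v + (sum (λ w → adj G v w * burst u k w) + sum (λ w → adj G v w * F w))
      ≡⟨ cong (λ z → σ v + z) (∑-distrib-+ (λ w → adj G v w * burst u k w) (λ w → adj G v w * F w)) ⟨
    σ v + sum (λ w → adj G v w * burst u k w + adj G v w * F w)
      ≡⟨ cong (λ z → σ v + z) (sum-cong-≗ (λ w → sym (*-distribˡ-+ (adj G v w) (burst u k w) (F w)))) ⟩
    σ v + sum (λ w → adj G v w * (burst u k w + F w)) ∎
    where
    at-sink : burst u k s + F s ≡ 0
    at-sink with s Fin.≟ u
    ... | yes s≡u = contradiction (sym s≡u) u≢s
    ... | no  _   = Fs≡0

  -- Phases of a run between halvings of the chip total.

  record Phase (H : ℕ) (σ : Config n) (m : ℕ) : Set where
    field
      early late : ℕ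
      F          : Fin n → ℕ
      splits     : m ≡ early + late
      fires      : Fires G d s σ F
      worked     : H * early ≤ 2 * n * (d * sum F)
      continues  : late ≡ 0 ⊎ ∃ λ σ′ → totalChips s σ′ < H × GreedyRun G s σ′ late

  no-firings : ∀ σ → Fires G d s σ (λ _ → 0)
  no-firings σ = refl , λ v _ → ≤-trans (≤-reflexive (*-zeroʳ d)) z≤n

  -- The cut falls at the first configuration with fewer than `H` chips, or at the end of the run.
  -- Each step before it has H ≤ 2ndk, and summing over these steps gives `worked`.
  phase : ∀ H {σ m} → GreedyRun G s σ m → Phase H σ m
  phase H (stop σ) = record
    { early = 0 ; late = 0 ; F = λ _ → 0 ; splits = refl ; fires = no-firings σ
    ; worked = ≤-trans (≤-reflexive (*-zeroʳ H)) z≤n ; continues = inj₁ refl }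
  phase H {σ} {m} run@(step {m = m′} st rest) with H ≤? totalChips s σ
  ... | no H≰N = record
    { early = 0 ; late = m ; F = λ _ → 0 ; splits = refl ; fires = no-firings σ
    ; worked = ≤-trans (≤-reflexive (*-zeroʳ H)) z≤n ; continues = inj₂ (σ , ≰⇒> H≰N , run) }
  ... | yes H≤N = record
    { early = suc early ; late = late ; F = λ v → burst (firer st) (multiplicity st) v + F v ; splits = cong suc splits
    ; fires = step-fires st fires ; worked = worked′ ; continues = continues }
    where
    open Phase (phase H rest)
    u = firer st
    k = multiplicity st
    regroup : ∀ n d k S → 2 * n * (d * k) + 2 * n * (d * S) ≡ 2 * n * (d * (k + S))
    regroup = solve-∀
    worked′ : H * suc early ≤ 2 * n * (d * sum (λ v → burst u k v + F v))
    worked′ = begin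
      H * suc early                                    ≡⟨ *-suc H early ⟩
      H + H * early                                    ≤⟨ +-mono-≤ (≤-trans H≤N (step-totalChips≤ st)) worked ⟩
      2 * n * (d * k) + 2 * n * (d * sum F)            ≡⟨ regroup n d k (sum F) ⟩
      2 * n * (d * (k + sum F))                        ≤⟨ *-monoʳ-≤ (2 * n) (*-monoʳ-≤ d (+-monoˡ-≤ (sum F) (≤-trans (≤-reflexive (sym (burst-at u k))) (f≤sum (burst u k) u)))) ⟩
      2 * n * (d * (sum (burst u k) + sum F))          ≡⟨ cong (λ z → 2 * n * (d * z)) (∑-distrib-+ (burst u k) F) ⟨
      2 * n * (d * sum (λ v → burst u k v + F v))      ∎

  -- Induction on `p`, one phase per power of two. With H = 2^p and N < 2H, the early steps satisfy
  -- H * early ≤ 2n · n · 2K · 2H, which is where the 8 comes from; the late ones start below 2^p.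
  run-bound : ∀ p {σ m} → GreedyRun G s σ m → totalChips s σ < 2 ^ p →
    m ≤ 8 * radiusConst q * (n * n) * p
  run-bound p       (stop σ)      _   = z≤n
  run-bound zero    (step st _)   N<1 = contradiction (step-totalChips>0 st) (<⇒≱ N<1)
  run-bound (suc p) {σ} {m} run@(step st _) N< = begin
    m                  ≡⟨ splits ⟩
    early + late       ≤⟨ +-mono-≤ early≤ late≤ ⟩
    C + C * p          ≡⟨ *-suc C p ⟨
    C * suc p          ∎
    where
    open Phase (phase (2 ^ p) run)
    K C : ℕ
    K = radiusConst q
    C = 8 * K * (n * n)
    dsum≤ : d * sum F ≤ n * (2 * (K * (2 * 2 ^ p)))
    dsum≤ = begin
      d * sum F                         ≡⟨ *-distribˡ-sum d F ⟩
      sum (λ v → d * F v)               ≤⟨ sum-bound _ (firings-bound (step-d>0 st) fires) ⟩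
      n * (2 * (K * totalChips s σ))    ≤⟨ *-monoʳ-≤ n (*-monoʳ-≤ 2 (*-monoʳ-≤ K (<⇒≤ N<))) ⟩
      n * (2 * (K * (2 * 2 ^ p)))       ∎
    collect : ∀ n K h → 2 * n * (n * (2 * (K * (2 * h)))) ≡ h * (8 * K * (n * n))
    collect = solve-∀
    early≤ : early ≤ C
    early≤ = *-cancelˡ-≤ (2 ^ p) {{m^n≢0 2 p}} (begin
      2 ^ p * early                             ≤⟨ worked ⟩
      2 * n * (d * sum F)                       ≤⟨ *-monoʳ-≤ (2 * n) dsum≤ ⟩
      2 * n * (n * (2 * (K * (2 * 2 ^ p))))     ≡⟨ collect n K (2 ^ p) ⟩
      2 ^ p * C                                 ∎)
    late≤ : late ≤ C * p
    late≤ with continues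
    ... | inj₁ late≡0          = subst (_≤ C * p) (sym late≡0) z≤n
    ... | inj₂ (_ , N′< , run′) = run-bound p run′ N′<

-- Rational expansion constants and the final estimate.

expander⇒expands : {G : Graph n} (ε : ℚ) → Positive ε → IsVertexExpander ε G → Expands (ℚ.↧ₙ ε) G
expander⇒expands {G = G} ε@(mkℚ (+ suc a) b _) _ expander X small = begin
  -- A positive rational has numerator at least 1, so it is at least the reciprocal of its
  -- denominator.
  x                    ≤⟨ m≤m+n x (a * x) ⟩
  suc a * x            ≡⟨ *-identityʳ (suc a * x) ⟨
  suc a * x * 1        ≤⟨ cross-multiplied ⟩
  y * (suc b * 1)      ≡⟨ cong (y *_) (*-identityʳ (suc b)) ⟩
  y * suc b            ≡⟨ *-comm y (suc b) ⟩
  suc b * y            ∎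
  where
  open ≤-Reasoning
  x y : ℕ
  x = count X
  y = count (boundary G X)
  -- In unnormalised form the product is not reduced, so the comparison unfolds to plain
  -- cross-multiplication.
  scaled : mkℚᵘ (+ suc a) b ℚᵘ.* mkℚᵘ (+ x) 0 ℚᵘ.≤ mkℚᵘ (+ y) 0
  scaled = ℚᵘ.≤-respʳ-≃ (ℚ.toℚᵘ-fromℚᵘ (mkℚᵘ (+ y) 0))
    (ℚᵘ.≤-respˡ-≃ (ℚᵘ.≃-trans (ℚ.toℚᵘ-homo-* ε (+ x ℚ./ 1)) (ℚᵘ.*-congˡ {mkℚᵘ (+ suc a) b} (ℚ.toℚᵘ-fromℚᵘ (mkℚᵘ (+ x) 0))))
      (ℚ.toℚᵘ-mono-≤ (expander X small)))
  cross-multiplied : suc a * x * 1 ≤ y * (suc b * 1)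
  cross-multiplied with scaled
  ... | *≤* p = ℤ.drop‿+≤+ (subst₂ ℤ._≤_ left right p)
    where
    left : (+ suc a ℤ.* + x) ℤ.* + 1 ≡ + (suc a * x * 1)
    left = trans (cong (ℤ._* + 1) (sym (ℤ.pos-* (suc a) x))) (sym (ℤ.pos-* (suc a * x) 1))
    right : + y ℤ.* + (suc b * 1) ≡ + (y * (suc b * 1))
    right = sym (ℤ.pos-* y (suc b * 1))

theorem4p9 : (ε : ℚ) → Positive ε →
    Σ ℕ λ C →
    ∀ (n d : ℕ) (G : Graph n) (s : Fin n) →
    IsSimple G → IsRegular G d → IsVertexExpander ε G →
    ∀ (σ : Config n) (m : ℕ) → GreedyRun G s σ m →
    m ≤ bound C n (totalChips s σ)
theorem4p9 ε ε>0 = C , λ n d G s simple reg expander σ m run → 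
  let N   = totalChips s σ
      n>0 = ≤-trans (s≤s z≤n) (toℕ<n s)
  in begin
    m                                                            ≤⟨ run-bound {q = ℚ.↧ₙ ε} (proj₁ simple) reg (expander⇒expands ε ε>0 expander) s (suc ⌈log₂ N ⌉) run (n<2^1+⌈log₂n⌉ N) ⟩
    -- The factor 1 + ⌈log₂ n⌉ is at least 1, and N ≤ nN because the sink witnesses n > 0.
    C * (n * n) * suc ⌈log₂ N ⌉                                  ≤⟨ *-mono-≤ (m≤m*n (C * (n * n)) (suc ⌈log₂ n ⌉)) (s≤s (⌈log₂⌉-mono-≤ (m≤n*m N n {{>-nonZero n>0}}))) ⟩
    C * (n * n) * suc ⌈log₂ n ⌉ * suc ⌈log₂ n * N ⌉              ∎
  where
  open ≤-Reasoning
  C : ℕ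
  C = 8 * radiusConst (ℚ.↧ₙ ε)
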